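{- There exists a family of COCOA $\mathcal{C}^1, \mathcal{C}^2, \ldots$ such that for each COCOA $\mathcal{C}^k = (A^k_1, \ldots, A^k_k)$ in the family: for all $1 \leq j \leq k$, the history-deterministic co-Büchi automaton $A^k_j$ only has two states; the language of $\mathcal{C}^k$ only has a single residual language; and every deterministic parity automaton $\mathcal{P}^k$ for the language of $\mathcal{C}^k$ needs at least $2^k$ states.
   Context: Here $\mathbb{N}$ contains $0$. For a language $L \subseteq \Sigma^\omega$ over a finite alphabet $\Sigma$ and $u \in \Sigma^*$, the residual language is $L|_u = \{w' \in \Sigma^\omega \mid uw' \in L\}$. Automata. Automata have transition-based acceptance: $\mathcal{A} = (Q,\Sigma,\delta,q_0)$ with finite state set $Q$, initial state $q_0$ and $\delta \subseteq Q \times \Sigma \times Q \times \mathbb{N}$; the last component of a transition is its color. Automata are input-complete, and the color of a transition depends only on its source state and letter. A run is accepting if the lowest color occurring infinitely often along it is even; a word is accepted if it has an accepting run; $\mathcal{L}(\mathcal{A})$ is the set of accepted words. $\mathcal{A}$ is deterministic if for each $(q,x)\in Q\times\Sigma$ there is exactly one $(q',c)$ with $(q,x,q',c)\in\delta$. A (deterministic) automaton of this form is a (deterministic) parity automaton. It is a co-Büchi automaton if its only colors are $1$ (rejecting) and $2$ (accepting). It is history-deterministic if its nondeterminism can be resolved letter by letter by an advice function of the finite prefix read so far, such that for every word in $\mathcal{L}(\mathcal{A})$ the resulting run is accepting. Natural colors. Fix an $\omega$-regular language $L$. For $w = w_0w_1\ldots \in \Sigma^\omega$, the word $w_0\ldots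 w_i \tilde w w_{i+1} w_{i+2}\ldots$ results from a residual language invariant injection of $\tilde w\in\Sigma^*$ at position $i$ if $L|_{w_0\ldots w_i} = L|_{w_0\ldots w_i\tilde w}$. A word $w$ is at home in a color of $i \in \mathbb{N}$ if there exists an (infinite) sequence of injection points $J \subset \mathbb{N}$ such that for all words $w'$ that result from injecting residual language invariant words at word positions in $J$ into $w$, either $w'$ is at home in a color strictly smaller than $i$, or both $w,w' \in L$ and $i$ is even, or both $w,w' \notin L$ and $i$ is odd (for $i=0$ only the latter kind of condition can apply). The natural color of $w$ (w.r.t. $L$) is the minimal color in which $w$ is at home. COCOA. A chain of co-Büchi automata (COCOA) for $L$ is a sequence $(A_1,\ldots,A_n)$ of history-deterministic co-Büchi automata with transition-based acceptance with $\mathcal{L}(A_1)\supset\cdots\supset\mathcal{L}(A_n)$ such that $A_1$ rejects exactly the words of natural color $0$ w.r.t. $L$ and, for each $1\le i\le n$, the words accepted by $A_i$ but rejected by $A_{i+1}$ (if $i<n$) are exactly those of natural color $i$ w.r.t. $L$. The language of the chain is the set of words $w$ such that $w\notin\mathcal{L}(A_1)$ or the highest $i$ with $w\in\mathcal{L}(A_i)$ is even (this set is $L$). -}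

module Defs where

open import Data.Fin.Base using (Fin; toℕ)
open import Data.List.Base using (List; []; _∷_; _++_; _∷ʳ_; applyUpTo)
open import Data.Nat.Base using (ℕ; zero; suc; _≤_; _<_)
open import Data.Nat.Divisibility using (_∣_; _∤_)
open import Data.Nat.InfinitelyOften using (Inf)
open import Data.Product using (Σ-syntax; ∃-syntax; ∃!; _×_; _,_)
open import Data.Sum.Base using (_⊎_)
open import Data.Vec.Base using (Vec; lookup)
open import Function.Base using (_∘_)
open import Level using (0ℓ)
open import Relation.Binary.PropositionalEquality.Core using (_≡_)
open import Relation.Unary using (Pred; _∈_; _∉_; _⊃_; _≐_; _∖_; _∪_; ∁)

Least : Pred ℕ 0ℓ → Pred ℕ 0ℓ
Least P i = i ∈ P × (∀ j → j ∈ P → i ≤ j)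

Greatest : Pred ℕ 0ℓ → Pred ℕ 0ℓ
Greatest P i = i ∈ P × (∀ j → j ∈ P → j ≤ i)

StrictlyIncreasing : Pred (ℕ → ℕ) 0ℓ
StrictlyIncreasing J = ∀ n → J n < J (suc n)

-- The finite alphabet is Fin m.
Word : ℕ → Set
Word m = ℕ → Fin m

Language : ℕ → Set₁
Language m = Pred (Word m) 0ℓ

module _ {m : ℕ} where

  prefix : Word m → ℕ → List (Fin m)
  prefix = applyUpTo

  infixr 5 _⌢_
  _⌢_ : List (Fin m) → Word m → Word m
  ([]      ⌢ w) n       = w n
  ((x ∷ u) ⌢ w) zero    = x
  ((x ∷ u) ⌢ w) (suc n) = (u ⌢ w) n

  residual : Language m → List (Fin m) → Language m
  residual L u w = u ⌢ w ∈ L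

  SingleResidual : Language m → Set
  SingleResidual L = ∀ u v → residual L u ≐ residual L v

record Automaton (m : ℕ) : Set₁ where
  field
    states   : ℕ
    δ        : Fin states → Fin m → Fin states → ℕ → Set
    initial  : Fin states
    complete : ∀ q x → ∃[ q′ ] ∃[ c ] δ q x q′ c
    colour-unique : ∀ {q x q₁ c₁ q₂ c₂} →
                    δ q x q₁ c₁ → δ q x q₂ c₂ → c₁ ≡ c₂

  State : Set
  State = Fin states

  -- A run consists of the states r visited and the colours c of the
  -- transitions taken.
  IsRun : Word m → (ℕ → State) → (ℕ → ℕ) → Set
  IsRun w r c = r 0 ≡ initial × (∀ i → δ (r i) (w i) (r (suc i)) (c i))

  Deterministic : Set
  Deterministic = ∀ q x → ∃! {A = State × ℕ} _≡_ λ (q′ , c) → δ q x q′ c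

  CoBüchi : Set
  CoBüchi = ∀ {q x q′ c} → δ q x q′ c → c ≡ 1 ⊎ c ≡ 2

-- The argument is the sequence of colours seen along a run.
Accepting : Pred (ℕ → ℕ) 0ℓ
Accepting c = ∃[ d ] Least (λ e → Inf (λ i → c i ≡ e)) d × 2 ∣ d

module _ {m : ℕ} where

  ⟦_⟧ : Automaton m → Language m
  ⟦ A ⟧ w = ∃[ r ] ∃[ c ] IsRun w r c × Accepting c
    where open Automaton A

  HistoryDeterministic : Automaton m → Set
  HistoryDeterministic A =
    Σ[ advice ∈ (List (Fin m) → State) ]
      advice [] ≡ initial
    × (∀ u x → ∃[ c ] δ (advice u) x (advice (u ∷ʳ x)) c)
    × (∀ w → w ∈ ⟦ A ⟧ → ∃[ c ] IsRun w (advice ∘ prefix w) c × Accepting c)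
    where open Automaton A

  ωRegular : Language m → Set₁
  ωRegular L = ∃[ A ] ⟦ A ⟧ ≐ L

  -- splice u w v is  u · w 0 · v 0 · w 1 · v 1 · …
  splice : List (Fin m) → Word m → (ℕ → List (Fin m)) → Word m
  splice []      w v zero    = w 0
  splice []      w v (suc n) = splice (v 0) (w ∘ suc) (v ∘ suc) n
  splice (x ∷ u) w v zero    = x
  splice (x ∷ u) w v (suc n) = splice u w v n

  -- Injects v i directly after the letter w i, for all i at once.
  inject : Word m → (ℕ → List (Fin m)) → Word m
  inject = splice []

  -- J lists the infinite set of allowed positions in increasing order.
  -- Because every v i leaves the residual language after w 0 … w i
  -- unchanged, it makes no difference whether invariance is measured in w
  -- or in the word already containing the earlier injections.
  InvariantInjection : Language m → (ℕ → ℕ) → Word m →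
                       Pred (ℕ → List (Fin m)) 0ℓ
  InvariantInjection L J w v = ∀ i →
      v i ≡ []
    ⊎ (∃[ n ] J n ≡ i)
      × residual L (prefix w (suc i)) ≐ residual L (prefix w (suc i) ++ v i)

  data AtHome (L : Language m) (i : ℕ) (w : Word m) : Set where
    atHome : (J : ℕ → ℕ) → StrictlyIncreasing J →
             (∀ v → InvariantInjection L J w v →
                (∃[ j ] j < i × AtHome L j (inject w v))
              ⊎ (w ∈ L × inject w v ∈ L × 2 ∣ i)
              ⊎ (w ∉ L × inject w v ∉ L × 2 ∤ i)) →
             AtHome L i w

  NaturalColour : Language m → ℕ → Language m
  NaturalColour L i w = Least (λ j → AtHome L j w) i

  module _ {n : ℕ} (C : Vec (Automaton m) n) where

    -- The language of the i-th automaton, counting from 1; empty if there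
    -- is no i-th automaton.
    Layer : ℕ → Language m
    Layer i w = ∃[ j ] suc (toℕ j) ≡ i × w ∈ ⟦ lookup C j ⟧

    ChainLanguage : Language m
    ChainLanguage =
      ∁ (Layer 1) ∪ λ w → ∃[ i ] Greatest (λ j → w ∈ Layer j) i × 2 ∣ i

    record IsCOCOAFor (L : Language m) : Set₁ where
      field
        regular   : ωRegular L
        coBüchi   : ∀ j → Automaton.CoBüchi (lookup C j)
        hd        : ∀ j → HistoryDeterministic (lookup C j)
        nested    : ∀ i → 1 ≤ i → i < n → Layer i ⊃ Layer (suc i)
        colour-0  : ∁ (Layer 1) ≐ NaturalColour L 0
        -- For i = n nothing is removed, since Layer (suc n) is empty.
        colour-i  : ∀ i → 1 ≤ i → i ≤ n →
                    Layer i ∖ Layer (suc i) ≐ NaturalColour L i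

    IsCOCOA : Set₁
    IsCOCOA = IsCOCOAFor ChainLanguage

-- The letters are pairs (j , b) with j < k and b ∈ {0 , 1}, and the i-th automaton accepts the
-- words in which, for some b, the letters (j , b) with j < i occur only finitely often. The level
-- of a word, the greatest i ≤ k such that the i-th automaton accepts it, is unaffected by finite
-- prefixes. Injections can only lower it, and injecting (i , 0) and (i , 1) infinitely often lowers
-- it exactly to i if it was larger; hence it is the natural colour. The language is the Muller
-- condition "the level is even", whose Zielonka tree is a complete binary tree of depth k.
--
-- For the lower bound, follow a branch of this tree and repeatedly move to a state that is
-- recurrent under the letters of the current node; recurrence under the earlier nodes persists.
-- The states found for two different branches differ: at the node where they part, a common state
-- would have loops through all letters of either child, of one parity, whose concatenation covers
-- the parent, of the other parity.

module Submission where

open import Defs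
open import Axiom.ExcludedMiddle using (ExcludedMiddle)
open import Data.Empty using (⊥)
open import Data.Fin.Base
  using (Fin; zero; suc; toℕ; fromℕ<; opposite; combine; quotient; remainder; finToFun; funToFin)
open import Data.Fin.Induction using (spo-noetherian)
open import Data.Fin.Properties
  using (_≟_; toℕ<n; toℕ-fromℕ<; toℕ-injective; toℕ-inject; remQuot-combine; funToFin-finToFin;
    finToFun-funToFin; injective⇒≤; ¬∀⟶∃¬-smallest)
open import Data.List.Base using (List; []; _∷_; _++_; foldl; allFin)
open import Data.List.Membership.Propositional using () renaming (_∈_ to _∈ₗ_)
open import Data.List.Membership.Propositional.Properties using (∈-++⁺ˡ; ∈-++⁺ʳ; ∈-++⁻; ∈-allFin)
open import Data.List.Properties using (foldl-++; foldl-∷ʳ)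
open import Data.List.Relation.Unary.All as All using (All; []; _∷_)
open import Data.List.Relation.Unary.All.Properties using (++⁺)
open import Data.List.Relation.Unary.Any using (here; there)
open import Data.Nat.Base using (ℕ; zero; suc; _+_; _*_; _^_; _≤_; _<_; z≤n; s≤s; s≤s⁻¹)
open import Data.Nat.Divisibility using (_∣_; _∤_; _∣?_; _∣0; ∣m+n∣m⇒∣n; ∣-refl; ∣1⇒≡1; ∣m∣n⇒∣m+n)
open import Data.Nat.Induction using (<-rec)
open import Data.Nat.InfinitelyOften using (Inf; _∪-Fin_) renaming (Fin to FinitelyOften)
open import Data.Nat.Properties
  using (≤-refl; ≤-reflexive; ≤-trans; ≤-antisym; ≤-total; <-irrefl; <⇒≤; <⇒≱; ≮⇒≥; <-≤-trans;
    ≤-<-trans; n<1+n; n≤1+n; suc-injective; m≤n⇒m<n∨m≡n; m≤m+n; m≤n+m; +-assoc; +-comm; +-identityʳ; _<?_)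
open import Data.Product.Base using (Σ; Σ-syntax; ∃; ∃-syntax; _×_; _,_; proj₁; proj₂)
open import Data.Sum.Base using (_⊎_; inj₁; inj₂; [_,_]′)
open import Data.Vec.Base using (Vec; lookup; tabulate)
open import Data.Vec.Properties using (lookup∘tabulate)
open import Function.Base using (_∘_; id; flip; case_of_)
open import Function.Bundles using (_⇔_; mk⇔; Equivalence)
open import Function.Properties.Equivalence using () renaming (sym to ⇔-sym; trans to ⇔-trans)
open import Induction.WellFounded using (Acc; acc)
open import Level using (0ℓ)
open import Relation.Binary.PropositionalEquality
  using (_≡_; _≢_; refl; sym; trans; cong; cong₂; subst; isEquivalence)
open import Relation.Binary.Structures using (IsStrictPartialOrder)
open import Relation.Nullary.Decidable using (Dec; yes; no; ¬?; _×-dec_; decidable-stable)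
open import Relation.Nullary.Negation using (¬_; contradiction)
open import Relation.Unary using (Pred; _∈_; _∉_; _≐_; _⊃_; ∁)

open Equivalence using (to; from)

-- Least elements and events that occur finitely or infinitely often

least-unique : ∀ {P i j} → Least P i → Least P j → i ≡ j
least-unique (Pi , i≤) (Pj , j≤) = ≤-antisym (i≤ _ Pj) (j≤ _ Pi)

cofinally⇒inf : ∀ {P : Pred ℕ 0ℓ} → (∀ N → ∃[ n ] N ≤ n × P n) → Inf P
cofinally⇒inf cof (N , never) with n , N≤n , p ← cof N = never n N≤n p

finitely-⊆ : ∀ {P Q : Pred ℕ 0ℓ} → (∀ {n} → P n → Q n) → FinitelyOften Q → FinitelyOften P
finitely-⊆ P⊆Q (N , never) = N , λ n N≤n → never n N≤n ∘ P⊆Q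

-- A finite union of finite events is finite. With `d` a bound on all colours, this shows that some
-- colour must recur.
finitely-≤ : ∀ {c : ℕ → ℕ} d → (∀ e → e ≤ d → FinitelyOften (λ n → c n ≡ e)) →
             FinitelyOften (λ n → c n ≤ d)
finitely-≤ zero    fin = finitely-⊆ (λ { z≤0 → ≤-antisym z≤0 z≤n }) (fin 0 z≤n)
finitely-≤ (suc d) fin =
  finitely-⊆ split (finitely-≤ d (λ e e≤d → fin e (≤-trans e≤d (n≤1+n d))) ∪-Fin fin (suc d) ≤-refl)
  where
  split : ∀ {x} → x ≤ suc d → x ≤ d ⊎ x ≡ suc d
  split x≤ with m≤n⇒m<n∨m≡n x≤
  ... | inj₁ x< = inj₁ (s≤s⁻¹ x<)
  ... | inj₂ x≡ = inj₂ x≡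

finitely-suc : ∀ {P : Pred ℕ 0ℓ} → FinitelyOften (P ∘ suc) → FinitelyOften P
finitely-suc (N , never) = suc N , λ { (suc n) (s≤s N≤n) → never n N≤n }

finitely-unsuc : ∀ {P : Pred ℕ 0ℓ} → FinitelyOften P → FinitelyOften (P ∘ suc)
finitely-unsuc (N , never) = N , λ n N≤n → never (suc n) (≤-trans N≤n (n≤1+n n))

eventually-constant : ∀ {A : Set} (s : ℕ → A) {N} → (∀ n → N ≤ n → s (suc n) ≡ s n) →
                      ∀ n → N ≤ n → s n ≡ s N
eventually-constant s {N} step zero    z≤n = refl
eventually-constant s {N} step (suc n) N≤sn with m≤n⇒m<n∨m≡n N≤sn
... | inj₂ refl = refl
... | inj₁ N<sn = trans (step n (s≤s⁻¹ N<sn)) (eventually-constant s step n (s≤s⁻¹ N<sn))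

accepting⇔even : ∀ {c d} → Least (λ e → Inf (λ i → c i ≡ e)) d → Accepting c ⇔ 2 ∣ d
accepting⇔even least = mk⇔ (λ (d′ , least′ , even) → subst (2 ∣_) (least-unique least′ least) even)
                           (λ even → _ , least , even)

-- Parity, the two sides, and first indices

even-suc : ∀ n → 2 ∣ n → 2 ∤ suc n
even-suc n 2∣n 2∣sn with () ← ∣1⇒≡1 (∣m+n∣m⇒∣n (subst (2 ∣_) (sym (+-comm n 1)) 2∣sn) 2∣n)

odd-suc : ∀ n → 2 ∤ n → 2 ∣ suc n
odd-suc zero          odd = contradiction (2 ∣0) odd
odd-suc (suc zero)    odd = ∣-refl
odd-suc (suc (suc n)) odd = ∣m∣n⇒∣m+n ∣-refl (odd-suc n λ even → odd (∣m∣n⇒∣m+n ∣-refl even))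

opposite-≢ : (b : Fin 2) → opposite b ≢ b
opposite-≢ zero       ()
opposite-≢ (suc zero) ()

≢-≢⇒≡ : ∀ {a b c : Fin 2} → a ≢ b → c ≢ b → a ≡ c
≢-≢⇒≡ {zero}     {_}        {zero}     p q = refl
≢-≢⇒≡ {suc zero} {_}        {suc zero} p q = refl
≢-≢⇒≡ {zero}     {zero}     {suc zero} p q = contradiction refl p
≢-≢⇒≡ {zero}     {suc zero} {suc zero} p q = contradiction refl q
≢-≢⇒≡ {suc zero} {zero}     {zero}     p q = contradiction refl q
≢-≢⇒≡ {suc zero} {suc zero} {zero}     p q = contradiction refl p

funToFin-cong : ∀ {m n} {f g : Fin m → Fin n} → (∀ i → f i ≡ g i) → funToFin f ≡ funToFin g
funToFin-cong {zero}  eq = refl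
funToFin-cong {suc m} eq = cong₂ combine (eq zero) (funToFin-cong (eq ∘ suc))

-- The value is `k` if no index satisfies `P`; as a colour, this default marks the transitions on
-- which no automaton of the chain rejects.
first : ∀ {k} {P : Pred (Fin k) 0ℓ} → (∀ j → Dec (P j)) → ℕ
first {zero}  P? = 0
first {suc k} P? with P? zero
... | yes _ = 0
... | no  _ = suc (first (P? ∘ suc))

first-≤ : ∀ {k} {P : Pred (Fin k) 0ℓ} (P? : ∀ j → Dec (P j)) → first P? ≤ k
first-≤ {zero}  P? = z≤n
first-≤ {suc k} P? with P? zero
... | yes _ = z≤n
... | no  _ = s≤s (first-≤ (P? ∘ suc))

first-holds : ∀ {k} {P : Pred (Fin k) 0ℓ} (P? : ∀ j → Dec (P j)) j → first P? ≡ toℕ j → P j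
first-holds {suc k} P? j eq with P? zero
first-holds {suc k} P? zero    eq | yes p = p
first-holds {suc k} P? (suc j) eq | no  _ = first-holds (P? ∘ suc) j (suc-injective eq)

first-lower : ∀ {k} {P : Pred (Fin k) 0ℓ} (P? : ∀ j → Dec (P j)) j → P j → first P? ≤ toℕ j
first-lower {suc k} P? j p with P? zero
first-lower {suc k} P? j       p | yes _ = z≤n
first-lower {suc k} P? zero    p | no ¬p = contradiction p ¬p
first-lower {suc k} P? (suc j) p | no _  = s≤s (first-lower (P? ∘ suc) j p)

-- Periodic words

-- cyc x u v is v · (x · u)^ω.
cyc : ∀ {A : Set} → A → List A → List A → ℕ → A
cyc x u []      zero    = x
cyc x u []      (suc n) = cyc x u u n
cyc x u (y ∷ v) zero    = y
cyc x u (y ∷ v) (suc n) = cyc x u v n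

module _ {A : Set} {x : A} {u : List A} where

  cyc-prefix : ∀ {y} v → y ∈ₗ v → ∃[ n ] cyc x u v n ≡ y
  cyc-prefix (_ ∷ v) (here refl) = 0 , refl
  cyc-prefix (_ ∷ v) (there y∈v) with n , eq ← cyc-prefix v y∈v = suc n , eq

  cyc-period : ∀ {y} v → y ∈ₗ x ∷ u → ∃[ n ] cyc x u v n ≡ y
  cyc-period []      (here refl) = 0 , refl
  cyc-period []      (there y∈u) with n , eq ← cyc-prefix u y∈u = suc n , eq
  cyc-period (_ ∷ v) y∈          with n , eq ← cyc-period v y∈ = suc n , eq

  cyc-cofinal : ∀ {y} v → y ∈ₗ x ∷ u → ∀ N → ∃[ n ] N ≤ n × cyc x u v n ≡ y
  cyc-cofinal v       y∈ zero    with n , eq ← cyc-period v y∈ = n , z≤n , eq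
  cyc-cofinal []      y∈ (suc N) with n , N≤n , eq ← cyc-cofinal u y∈ N = suc n , s≤s N≤n , eq
  cyc-cofinal (_ ∷ v) y∈ (suc N) with n , N≤n , eq ← cyc-cofinal v y∈ N = suc n , s≤s N≤n , eq

  cyc-inf : ∀ {y} v → y ∈ₗ x ∷ u → Inf (λ n → cyc x u v n ≡ y)
  cyc-inf v y∈ = cofinally⇒inf (cyc-cofinal v y∈)

  cyc-all : ∀ {P : Pred A 0ℓ} v → All P (x ∷ u) → All P v → ∀ n → P (cyc x u v n)
  cyc-all []      (px ∷ pu) []        zero    = px
  cyc-all []      (px ∷ pu) []        (suc n) = cyc-all u (px ∷ pu) pu n
  cyc-all (y ∷ v) pxu       (py ∷ pv) zero    = py
  cyc-all (y ∷ v) pxu       (py ∷ pv) (suc n) = cyc-all v pxu pv n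

  cyc-finite : ∀ (P : Pred A 0ℓ) v → (∀ {y} → y ∈ₗ x ∷ u → ¬ P y) →
               FinitelyOften (λ n → P (cyc x u v n))
  cyc-finite P []      ¬p = 0 , λ n _ → cyc-all {∁ P} [] (All.tabulate ¬p) [] n
  cyc-finite P (y ∷ v) ¬p = finitely-suc (cyc-finite P v ¬p)

-- Concatenation and injection

module _ {m : ℕ} where

  ⌢-finitely : ∀ (P : Pred (Fin m) 0ℓ) u w →
               FinitelyOften (P ∘ w) ⇔ FinitelyOften (P ∘ (u ⌢ w))
  ⌢-finitely P u w = mk⇔ (forth u) (back u)
    where
    forth : ∀ u → FinitelyOften (P ∘ w) → FinitelyOften (P ∘ (u ⌢ w))
    forth []      fin = fin
    forth (x ∷ u) fin = finitely-suc (forth u fin)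

    back : ∀ u → FinitelyOften (P ∘ (u ⌢ w)) → FinitelyOften (P ∘ w)
    back []      fin = fin
    back (x ∷ u) fin = back u (finitely-unsuc fin)

  splice-head : ∀ u (w : Word m) v → ∃[ n ] ∀ t → splice u w v (n + t) ≡ splice [] w v t
  splice-head []      w v = 0 , λ t → refl
  splice-head (x ∷ u) w v with n , eq ← splice-head u w v = suc n , eq

  -- From the counterpart of position `i` onwards, the injected word is again an injection, into the
  -- tail of `w`. Injecting only delays letters, whence `i ≤ n`.
  splice-shift : ∀ u (w : Word m) v i → ∃[ n ] i ≤ n ×
                 (∀ t → splice u w v (n + t) ≡ splice [] (w ∘ (i +_)) (v ∘ (i +_)) t)
  splice-shift u w v zero with n , eq ← splice-head u w v = n , z≤n , eq
  splice-shift u w v (suc i)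
    with n , eq ← splice-head u w v
       | n′ , i≤n′ , eq′ ← splice-shift (v 0) (w ∘ suc) (v ∘ suc) i
    = n + suc n′ , ≤-trans (s≤s i≤n′) (m≤n+m (suc n′) n) ,
      λ t → trans (cong (splice u w v) (+-assoc n (suc n′) t)) (trans (eq (suc n′ + t)) (eq′ t))

  splice-member : ∀ {x} u (w : Word m) v → x ∈ₗ u → ∃[ n ] splice u w v n ≡ x
  splice-member (_ ∷ u) w v (here refl) = 0 , refl
  splice-member (_ ∷ u) w v (there x∈u) with n , eq ← splice-member u w v x∈u = suc n , eq

  splice-all : ∀ {P : Pred (Fin m) 0ℓ} u {w : Word m} {v} → All P u → (∀ n → P (w n)) →
               (∀ i → All P (v i)) → ∀ n → P (splice u w v n)
  splice-all []      []        pw pv zero    = pw 0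
  splice-all []      []        pw pv (suc n) = splice-all _ (pv 0) (pw ∘ suc) (pv ∘ suc) n
  splice-all (x ∷ u) (px ∷ pu) pw pv zero    = px
  splice-all (x ∷ u) (px ∷ pu) pw pv (suc n) = splice-all u pu pw pv n

  inject-finitely⁻ : ∀ (P : Pred (Fin m) 0ℓ) w v →
                     FinitelyOften (P ∘ inject w v) → FinitelyOften (P ∘ w)
  inject-finitely⁻ P w v (N , never) = N , λ i N≤i p →
    let n , i≤n , eq = splice-shift [] w v i
    in never (n + 0) (≤-trans N≤i (≤-trans i≤n (m≤m+n n 0)))
         (subst P (sym (trans (eq 0) (cong w (+-identityʳ i)))) p)

  inject-finitely⁺ : ∀ (P : Pred (Fin m) 0ℓ) w v → (∀ i → All (∁ P) (v i)) →
                     FinitelyOften (P ∘ w) → FinitelyOften (P ∘ inject w v)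
  inject-finitely⁺ P w v ¬pv (N , never) with n , _ , eq ← splice-shift [] w v N =
    n , λ i n≤i p → let t , n+t≡i = ≤⇒∃+ n≤i in
      splice-all {P = ∁ P} [] [] (λ j → never (N + j) (m≤m+n N j)) (λ j → ¬pv (N + j)) t
        (subst P (trans (cong (inject w v) (sym n+t≡i)) (eq t)) p)
    where
    ≤⇒∃+ : ∀ {a b} → a ≤ b → ∃[ t ] a + t ≡ b
    ≤⇒∃+ z≤n       = _ , refl
    ≤⇒∃+ (s≤s a≤b) with t , eq ← ≤⇒∃+ a≤b = t , cong suc eq

  inject-inf : ∀ {x w v} {J : ℕ → ℕ} → StrictlyIncreasing J → (∀ n → x ∈ₗ v (J n)) →
               Inf (λ n → inject w v n ≡ x)
  inject-inf {x} {w} {v} {J} inc x∈v = cofinally⇒inf λ N →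
    let n , JN≤n , eq = splice-shift [] w v (J N)
        t , eq′       = splice-member (v (J N + 0)) (w ∘ (J N +_) ∘ suc) (v ∘ (J N +_) ∘ suc)
                          (subst (λ i → x ∈ₗ v i) (sym (+-identityʳ (J N))) (x∈v N))
    -- The letter of `w` at position `J N` comes first, so the injected block starts one position
    -- later.
    in n + suc t , ≤-trans (≤-J N) (≤-trans JN≤n (m≤m+n n (suc t))) , trans (eq (suc t)) eq′
    where
    ≤-J : ∀ n → n ≤ J n
    ≤-J zero    = z≤n
    ≤-J (suc n) = ≤-<-trans (≤-J n) (inc n)

-- Deterministic automata

module Runs {m s : ℕ} (next : Fin s → Fin m → Fin s) where

  steps : Fin s → List (Fin m) → Fin s
  steps = foldl next

  run : Fin s → Word m → ℕ → Fin s
  run q w = steps q ∘ prefix w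

  run-suc : ∀ q w n → run q w (suc n) ≡ next (run q w n) (w n)
  run-suc q w zero    = refl
  run-suc q w (suc n) = run-suc (next q (w 0)) (w ∘ suc) n

module _ {m s : ℕ} (initial : Fin s) (next : Fin s → Fin m → Fin s) (colour : Fin s → Fin m → ℕ) where

  functional : Automaton m
  functional = record
    { states        = s
    ; δ             = λ q x q′ c → q′ ≡ next q x × c ≡ colour q x
    ; initial       = initial
    ; complete      = λ q x → next q x , colour q x , refl , refl
    ; colour-unique = λ (_ , c≡) (_ , c′≡) → trans c≡ (sym c′≡)
    }

  functional-deterministic : Automaton.Deterministic functional
  functional-deterministic q x =
    (next q x , colour q x) , (refl , refl) , λ (q≡ , c≡) → cong₂ _,_ (sym q≡) (sym c≡)

module Determinism {m : ℕ} (A : Automaton m) (det : Automaton.Deterministic A) where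

  open Automaton A

  next : State → Fin m → State
  next q x = proj₁ (proj₁ (det q x))

  colour : State → Fin m → ℕ
  colour q x = proj₂ (proj₁ (det q x))

  open Runs next public

  colours : Word m → ℕ → ℕ
  colours w i = colour (run initial w i) (w i)

  transition : ∀ q x → δ q x (next q x) (colour q x)
  transition q x = proj₁ (proj₂ (det q x))

  transition-unique : ∀ {q x q′ c} → δ q x q′ c → (next q x , colour q x) ≡ (q′ , c)
  transition-unique {q} {x} t = proj₂ (proj₂ (det q x)) t

  isRun : ∀ w → IsRun w (run initial w) (colours w)
  isRun w = refl , λ i → subst (λ q → δ (run initial w i) (w i) q (colours w i))
                               (sym (run-suc initial w i)) (transition _ _)

  accepting-resp : ∀ {c c′} → (∀ i → c i ≡ c′ i) → Accepting c → Accepting c′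
  accepting-resp c≡c′ (d , (inf , least) , even) =
    d , (inf ∘ finitely-⊆ (trans (sym (c≡c′ _)))
        , λ e inf′ → least e (inf′ ∘ finitely-⊆ (trans (c≡c′ _)))) , even

  ∈⇔accepting : ∀ {w} → w ∈ ⟦ A ⟧ ⇔ Accepting (colours w)
  ∈⇔accepting {w} = mk⇔ accepts λ ac → run initial w , colours w , isRun w , ac
    where
    accepts : w ∈ ⟦ A ⟧ → Accepting (colours w)
    accepts (r , c , (r₀ , ts) , ac) = accepting-resp
      (λ i → trans (sym (cong proj₂ (transition-unique (ts i)))) (cong (λ q → colour q (w i)) (r≡ i))) ac
      where
      r≡ : ∀ i → r i ≡ run initial w i
      r≡ zero    = r₀
      r≡ (suc i) = trans (sym (cong proj₁ (transition-unique (ts i))))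
                         (trans (cong (λ q → next q (w i)) (r≡ i)) (sym (run-suc initial w i)))

  historyDeterministic : HistoryDeterministic A
  historyDeterministic =
    steps initial , refl ,
    (λ u x → colour (steps initial u) x ,
      subst (λ q → δ (steps initial u) x q (colour (steps initial u) x))
            (sym (foldl-∷ʳ next initial x u)) (transition _ _)) ,
    λ w w∈A → colours w , isRun w , to ∈⇔accepting w∈A

  coloursAlong : State → List (Fin m) → List ℕ
  coloursAlong q []      = []
  coloursAlong q (x ∷ u) = colour q x ∷ coloursAlong (next q x) u

  coloursAlong-++ : ∀ q u v → coloursAlong q (u ++ v) ≡ coloursAlong q u ++ coloursAlong (steps q u) v
  coloursAlong-++ q []      v = refl
  coloursAlong-++ q (x ∷ u) v = cong (colour q x ∷_) (coloursAlong-++ (next q x) u v)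

  IsMinimum : List ℕ → ℕ → Set
  IsMinimum cs d = d ∈ₗ cs × All (d ≤_) cs

  module _ {q x u} (loop : steps q (x ∷ u) ≡ q) where

    -- Each period leads from `q` back to `q`, so the colours form an ultimately periodic sequence
    -- of the same shape as the word.
    colours-cyc : ∀ n s v → steps s v ≡ q →
                  colour (run s (cyc x u v) n) (cyc x u v n) ≡
                  cyc (colour q x) (coloursAlong (next q x) u) (coloursAlong s v) n
    colours-cyc zero    s []      refl = refl
    colours-cyc (suc n) s []      refl = colours-cyc n (next q x) u loop
    colours-cyc zero    s (y ∷ v) eq   = refl
    colours-cyc (suc n) s (y ∷ v) eq   = colours-cyc n (next s y) v eq

    -- Exactly the colours on the loop recur, so the least of them decides acceptance.
    cyc∈⇔even : ∀ {d} v → steps initial v ≡ q → IsMinimum (coloursAlong q (x ∷ u)) d →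
                cyc x u v ∈ ⟦ A ⟧ ⇔ 2 ∣ d
    cyc∈⇔even {d} v eq (d∈ , d≤) = ⇔-trans ∈⇔accepting (accepting⇔even (inf , least))
      where
      colours≡ : ∀ n → colours (cyc x u v) n ≡
                       cyc (colour q x) (coloursAlong (next q x) u) (coloursAlong initial v) n
      colours≡ n = colours-cyc n initial v eq

      inf : Inf (λ n → colours (cyc x u v) n ≡ d)
      inf = cyc-inf (coloursAlong initial v) d∈ ∘ finitely-⊆ (trans (colours≡ _))

      least : ∀ e → Inf (λ n → colours (cyc x u v) n ≡ e) → d ≤ e
      least e inf-e = ≮⇒≥ λ e<d → inf-e
        (finitely-⊆ (trans (sym (colours≡ _)))
          (cyc-finite (_≡ e) (coloursAlong initial v) λ { y∈ refl → <⇒≱ e<d (All.lookup d≤ y∈) }))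

minimum-exists : ∀ (c : ℕ) cs → ∃[ d ] d ∈ₗ c ∷ cs × All (d ≤_) (c ∷ cs)
minimum-exists c []       = c , here refl , ≤-refl ∷ []
minimum-exists c (e ∷ cs) with d , d∈ , d≤ ← minimum-exists e cs | ≤-total c d
... | inj₁ c≤d = c , here refl , ≤-refl ∷ All.map (≤-trans c≤d) d≤
... | inj₂ d≤c = d , there d∈ , d≤c ∷ d≤

module _ (em : ExcludedMiddle 0ℓ) where

  finitely-stable : ∀ {P : Pred ℕ 0ℓ} → ¬ Inf P → FinitelyOften P
  finitely-stable = decidable-stable em

  -- Maximal elements of a finite preorder

  module _ {n : ℕ} {R : Fin n → Fin n → Set} (R-refl : ∀ {p} → R p p)
           (R-trans : ∀ {p q r} → R p q → R q r → R p r) where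

    -- The strict part of the preorder has no infinite ascending chain, so climbing stops. For
    -- reachability in an automaton this finds a terminal strongly connected component.
    maximal-above : ∀ p → ∃[ q ] R p q × (∀ {r} → R q r → R r q)
    maximal-above p = go p (spo-noetherian spo p)
      where
      _⊏_ : Fin n → Fin n → Set
      p ⊏ q = R p q × ¬ R q p

      spo : IsStrictPartialOrder _≡_ _⊏_
      spo = record
        { isEquivalence = isEquivalence
        ; irrefl        = λ { refl (r , ¬r) → ¬r r }
        ; trans         = λ (pq , ¬qp) (qr , ¬rq) → R-trans pq qr , λ rp → ¬qp (R-trans qr rp)
        ; <-resp-≈      = (λ { refl → id }) , λ { refl → id }
        }

      go : ∀ p → Acc (flip _⊏_) p → ∃[ q ] R p q × (∀ {r} → R q r → R r q)
      go p (acc rs) with em {∃[ q ] p ⊏ q}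
      ... | yes (q , pq@(Rpq , _)) with r , Rqr , max ← go q (rs pq) = r , R-trans Rpq Rqr , max
      ... | no  none = p , R-refl , λ Rpr → decidable-stable em λ ¬Rrp → none (_ , Rpr , ¬Rrp)

  module Family (k : ℕ) where

    -- Letters, depth and level

    Letter : Set
    Letter = Fin (k * 2)

    letter : Fin k → Fin 2 → Letter
    letter = combine

    index : Letter → Fin k
    index = quotient 2

    side : Letter → Fin 2
    side = remainder {k} 2

    index-letter : ∀ j b → index (letter j b) ≡ j
    index-letter j b = cong proj₁ (remQuot-combine j b)

    side-letter : ∀ j b → side (letter j b) ≡ b
    side-letter j b = cong proj₂ (remQuot-combine j b)

    Relevant : ℕ → Pred Letter 0ℓ
    Relevant i x = toℕ (index x) < i

    Hits : ℕ → Fin 2 → Pred Letter 0ℓ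
    Hits i b x = Relevant i x × side x ≡ b

    Calm : ℕ → Language (k * 2)
    Calm i w = ∃[ b ] FinitelyOften (λ n → Hits i b (w n))

    -- The bound on `i` makes every level at most `k`: all letters are relevant from `k` on, so a
    -- word calm at `k` is calm at every larger index.
    Deep : ℕ → Language (k * 2)
    Deep i w = i ≤ k × Calm i w

    Level : ℕ → Language (k * 2)
    Level i w = Deep i w × ¬ Deep (suc i) w

    deep-0 : ∀ w → Deep 0 w
    deep-0 w = z≤n , zero , 0 , λ { _ _ (() , _) }

    deep-antitone : ∀ {i j w} → i ≤ j → Deep j w → Deep i w
    deep-antitone i≤j (j≤k , b , fin) =
      ≤-trans i≤j j≤k , b , finitely-⊆ (λ (rel , s≡) → <-≤-trans rel i≤j , s≡) fin

    level-greatest : ∀ {i j w} → Level i w → Deep j w → j ≤ i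
    level-greatest (_ , ¬deep) deep = ≮⇒≥ λ i<j → ¬deep (deep-antitone i<j deep)

    level-exists : ∀ w → ∃[ i ] Level i w
    level-exists w = search k λ (k<k , _) → <-irrefl refl k<k
      where
      search : ∀ i → ¬ Deep (suc i) w → ∃[ j ] Level j w
      search zero    ¬deep = 0 , deep-0 w , ¬deep
      search (suc i) ¬deep with em {Deep (suc i) w}
      ... | yes deep = suc i , deep , ¬deep
      ... | no ¬deep′ = search i ¬deep′

    letter-hits : ∀ {i} j b → toℕ j < i → Hits i b (letter j b)
    letter-hits j b j<i = subst (λ j → toℕ j < _) (sym (index-letter j b)) j<i , side-letter j b

    hits-letter : ∀ {i b c} j → Hits i b (letter j c) → toℕ j < i × c ≡ b
    hits-letter {i} {c = c} j (rel , side≡) =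
      subst (λ j → toℕ j < i) (index-letter j c) rel , trans (sym (side-letter j c)) side≡

    -- If both letters of index `i` recur, neither side can be finite among the letters of index at
    -- most `i`. For `i = k` there are no such letters, and the level is `k` by its bound.
    level-intro : ∀ {i w} → i ≤ k → Calm i w →
                  (∀ j b → toℕ j ≡ i → Inf (λ n → w n ≡ letter j b)) → Level i w
    level-intro {i} {w} i≤k calm often = (i≤k , calm) , λ (i<k , b , fin) →
      often (fromℕ< i<k) b (toℕ-fromℕ< i<k)
        (finitely-⊆ (λ w≡ → subst (Hits (suc i) b) (sym w≡)
           (letter-hits _ b (≤-reflexive (cong suc (toℕ-fromℕ< i<k))))) fin)

    -- The automata

    -- The state of the i-th automaton is the side of the last letter of index below i.
    Kill : ℕ → Fin 2 → Pred Letter 0ℓ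
    Kill i q x = Relevant i x × side x ≢ q

    kill? : ∀ i q x → Dec (Kill i q x)
    kill? i q x = (toℕ (index x) <? i) ×-dec ¬? (side x ≟ q)

    track : ℕ → Fin 2 → Letter → Fin 2
    track i q x with toℕ (index x) <? i
    ... | yes _ = side x
    ... | no  _ = q

    track-relevant : ∀ {i} q {x} → Relevant i x → track i q x ≡ side x
    track-relevant {i} q {x} rel with toℕ (index x) <? i
    ... | yes _    = refl
    ... | no ¬rel = contradiction rel ¬rel

    track-unkilled : ∀ i q x → ¬ Kill i q x → track i q x ≡ q
    track-unkilled i q x ¬kill with toℕ (index x) <? i
    ... | yes rel = decidable-stable (side x ≟ q) λ s≢q → ¬kill (rel , s≢q)
    ... | no _    = refl

    track-≢ : ∀ {i q b x} → q ≢ b → ¬ Hits i b x → track i q x ≢ b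
    track-≢ {i} {q} {b} {x} q≢b ¬hits with toℕ (index x) <? i
    ... | yes rel = λ s≡b → ¬hits (rel , s≡b)
    ... | no _    = q≢b

    -- The sequence `s` may start anywhere and need not come from a particular automaton, so the
    -- results serve runs of a tracker as well as single coordinates of the product below.
    module _ {i} {w : Word (k * 2)} {s : ℕ → Fin 2} (s-suc : ∀ n → s (suc n) ≡ track i (s n) (w n)) where

      kills : Pred ℕ 0ℓ
      kills n = Kill i (s n) (w n)

      -- After the last kill the state is constant, and every relevant letter has that state as its
      -- side; the opposite side no longer occurs.
      kills-finite⇒calm : FinitelyOften kills → Calm i w
      kills-finite⇒calm (N , never) = opposite (s N) , N , λ n N≤n (rel , side≡) → never n N≤n
        (rel , λ side≡s → opposite-≢ (s N) (trans (sym side≡) (trans side≡s (constant n N≤n))))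
        where
        constant : ∀ n → N ≤ n → s n ≡ s N
        constant = eventually-constant s λ n N≤n → trans (s-suc n) (track-unkilled i (s n) (w n) (never n N≤n))

      -- After the last hit of b, the first kill moves the state away from b, and it stays there.
      calm⇒kills-finite : Calm i w → FinitelyOften kills
      calm⇒kills-finite (b , N , never) with em {∃[ n ] N ≤ n × kills n}
      ... | no none = N , λ n N≤n kill → none (n , N≤n , kill)
      ... | yes (M , N≤M , rel , _) = suc M , λ n M<n (rel , side≢) →
              side≢ (≢-≢⇒≡ (λ side≡b → never n (≤-trans N≤M (<⇒≤ M<n)) (rel , side≡b)) (away n M<n))
        where
        away : ∀ n → M < n → s n ≢ b
        away (suc n) M<sn sn≡b with m≤n⇒m<n∨m≡n (s≤s⁻¹ M<sn)
        ... | inj₂ refl = never M N≤M (rel , trans (sym (trans (s-suc M) (track-relevant (s M) rel))) sn≡b)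
        ... | inj₁ M<n  = track-≢ {x = w n} (away n M<n) (never n (≤-trans N≤M (<⇒≤ M<n))) (trans (sym (s-suc n)) sn≡b)

    trackerColour : ℕ → Fin 2 → Letter → ℕ
    trackerColour i q x with kill? i q x
    ... | yes _ = 1
    ... | no  _ = 2

    data TrackerColour i q x : ℕ → Set where
      killed   : Kill i q x → TrackerColour i q x 1
      unkilled : ¬ Kill i q x → TrackerColour i q x 2

    trackerColour-spec : ∀ i q x → TrackerColour i q x (trackerColour i q x)
    trackerColour-spec i q x with kill? i q x
    ... | yes kill = killed kill
    ... | no ¬kill = unkilled ¬kill

    tracker : ℕ → Automaton (k * 2)
    tracker i = functional zero (track i) (trackerColour i)

    tracker-deterministic : ∀ i → Automaton.Deterministic (tracker i)
    tracker-deterministic i = functional-deterministic zero (track i) (trackerColour i)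

    tracker-coBüchi : ∀ i → Automaton.CoBüchi (tracker i)
    tracker-coBüchi i {q} {x} (_ , refl) with trackerColour i q x | trackerColour-spec i q x
    ... | _ | killed _   = inj₁ refl
    ... | _ | unkilled _ = inj₂ refl

    module _ (i : ℕ) {w : Word (k * 2)} where

      open Determinism (tracker i) (tracker-deterministic i) using (run; run-suc; colours; ∈⇔accepting)

      private
        c : ℕ → ℕ
        c = colours w

        spec : ∀ n → TrackerColour i (run zero w n) (w n) (c n)
        spec n = trackerColour-spec i _ _

        c≡1⇒kill : ∀ {n} → c n ≡ 1 → Kill i (run zero w n) (w n)
        c≡1⇒kill {n} eq with c n | spec n
        ... | _ | killed kill = kill
        c≡1⇒kill () | _ | unkilled _

        kill⇒c≡1 : ∀ {n} → Kill i (run zero w n) (w n) → c n ≡ 1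
        kill⇒c≡1 {n} kill with c n | spec n
        ... | _ | killed _       = refl
        ... | _ | unkilled ¬kill = contradiction kill ¬kill

        c≢0 : ∀ {n} → c n ≢ 0
        c≢0 {n} eq with c n | spec n
        c≢0 () | _ | killed _
        c≢0 () | _ | unkilled _

        c≤2 : ∀ n → c n ≤ 2
        c≤2 n with c n | spec n
        ... | _ | killed _   = s≤s z≤n
        ... | _ | unkilled _ = ≤-refl

        accepting⇒finite : Accepting c → FinitelyOften (λ n → c n ≡ 1)
        accepting⇒finite (d , (inf , least) , even) = finitely-stable λ inf₁ → case d (least 1 inf₁) inf even
          where
          case : ∀ d → d ≤ 1 → Inf (λ n → c n ≡ d) → 2 ∣ d → ⊥
          case zero       _ inf even = inf (0 , λ _ _ → c≢0)
          case (suc zero) _ inf even = even-suc 0 (2 ∣0) even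
          case (suc (suc _)) (s≤s ())

        finite⇒accepting : FinitelyOften (λ n → c n ≡ 1) → Accepting c
        finite⇒accepting fin = 2 , (inf , least) , ∣-refl
          where
          fin≤1 : ∀ e → e ≤ 1 → FinitelyOften (λ n → c n ≡ e)
          fin≤1 zero       _ = 0 , λ _ _ → c≢0
          fin≤1 (suc zero) _ = fin
          fin≤1 (suc (suc _)) (s≤s ())

          inf : Inf (λ n → c n ≡ 2)
          inf fin₂ = let N , never = finitely-≤ 2 fin≤2 in never N ≤-refl (c≤2 N)
            where
            fin≤2 : ∀ e → e ≤ 2 → FinitelyOften (λ n → c n ≡ e)
            fin≤2 e e≤2 with m≤n⇒m<n∨m≡n e≤2
            ... | inj₁ e<2  = fin≤1 e (s≤s⁻¹ e<2)
            ... | inj₂ refl = fin₂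

          least : ∀ e → Inf (λ n → c n ≡ e) → 2 ≤ e
          least e inf-e = ≮⇒≥ λ e<2 → inf-e (fin≤1 e (s≤s⁻¹ e<2))

      ∈tracker⇔calm : w ∈ ⟦ tracker i ⟧ ⇔ Calm i w
      ∈tracker⇔calm = mk⇔
        (kills-finite⇒calm {w = w} s-suc ∘ finitely-⊆ kill⇒c≡1 ∘ accepting⇒finite ∘ to ∈⇔accepting)
        (from ∈⇔accepting ∘ finite⇒accepting ∘ finitely-⊆ c≡1⇒kill ∘ calm⇒kills-finite {w = w} s-suc)
        where
        s-suc : ∀ n → run zero w (suc n) ≡ track i (run zero w n) (w n)
        s-suc = run-suc zero w

    -- The chain and its language

    chain : Vec (Automaton (k * 2)) k
    chain = tabulate λ j → tracker (suc (toℕ j))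

    lookup-chain : ∀ j → lookup chain j ≡ tracker (suc (toℕ j))
    lookup-chain = lookup∘tabulate _

    L : Language (k * 2)
    L = ChainLanguage chain

    layer⇒deep : ∀ {i w} → Layer chain i w → Deep i w
    layer⇒deep {w = w} (j , refl , w∈) =
      toℕ<n j , to (∈tracker⇔calm _) (subst (λ A → w ∈ ⟦ A ⟧) (lookup-chain j) w∈)

    deep⇒layer : ∀ {i w} → Deep (suc i) w → Layer chain (suc i) w
    deep⇒layer {i} {w} (i<k , calm) = j , cong suc j≡i ,
      subst (λ A → w ∈ ⟦ A ⟧) (sym (lookup-chain j))
        (from (∈tracker⇔calm _) (subst (λ i → Calm (suc i) w) (sym j≡i) calm))
      where
      j : Fin k
      j = fromℕ< i<k

      j≡i : toℕ j ≡ i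
      j≡i = toℕ-fromℕ< i<k

    -- A positive level is the greatest index of a layer containing the word. Level `0` means lying
    -- outside the first layer, which the chain accepts too.
    level⇒∈⇔even : ∀ {i w} → Level i w → w ∈ L ⇔ 2 ∣ i
    level⇒∈⇔even {i} {w} lv = mk⇔ (even i lv) (member i lv)
      where
      even : ∀ i → Level i w → w ∈ L → 2 ∣ i
      even zero    lv         _                = 2 ∣0
      even (suc i) (deep , _) (inj₁ ∉layer-1) =
        contradiction (deep⇒layer (deep-antitone (s≤s z≤n) deep)) ∉layer-1
      even (suc i) lv         (inj₂ (j , (layer , j-max) , 2∣j)) =
        subst (2 ∣_) (≤-antisym (level-greatest lv (layer⇒deep layer)) (j-max _ (deep⇒layer (proj₁ lv)))) 2∣j

      member : ∀ i → Level i w → 2 ∣ i → w ∈ L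
      member zero    (_ , ¬deep)   _    = inj₁ (¬deep ∘ layer⇒deep)
      member (suc i) lv@(deep , _) 2∣si =
        inj₂ (suc i , (deep⇒layer deep , λ j → level-greatest lv ∘ layer⇒deep) , 2∣si)

    level-∈⇔ : ∀ {i w w′} → Level i w → Level i w′ → w ∈ L ⇔ w′ ∈ L
    level-∈⇔ lv lv′ = ⇔-trans (level⇒∈⇔even lv) (⇔-sym (level⇒∈⇔even lv′))

    deep-⌢ : ∀ {i} u w → Deep i w ⇔ Deep i (u ⌢ w)
    deep-⌢ u w = mk⇔ (λ (i≤k , b , fin) → i≤k , b , to   (⌢-finitely (Hits _ b) u w) fin)
                     (λ (i≤k , b , fin) → i≤k , b , from (⌢-finitely (Hits _ b) u w) fin)

    residual-L : ∀ u {w} → w ∈ L ⇔ u ⌢ w ∈ L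
    residual-L u {w} with i , lv@(deep , ¬deep) ← level-exists w =
      level-∈⇔ lv (to (deep-⌢ u w) deep , ¬deep ∘ from (deep-⌢ u w))

    -- This also makes every injection residual language invariant, so natural colours are governed
    -- by arbitrary injections at the chosen positions.
    singleResidual : SingleResidual L
    singleResidual u v = to (residual-L v) ∘ from (residual-L u) , to (residual-L u) ∘ from (residual-L v)

    -- Natural colours

    deep-inject⁻ : ∀ {i w v} → Deep i (inject w v) → Deep i w
    deep-inject⁻ {i} {w} {v} (i≤k , b , fin) = i≤k , b , inject-finitely⁻ (Hits i b) w v fin

    -- All positions can serve as injection points: an injection either keeps the level, and with it
    -- membership, or lowers it, and then induction applies.
    level⇒atHome : ∀ i {w} → Level i w → AtHome L i w
    level⇒atHome = <-rec _ λ i rec {w} lv → atHome id n<1+n λ v _ →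
      respond i rec lv v (level-exists (inject w v))
      where
      respond : ∀ i → (∀ {j} → j < i → ∀ {w} → Level j w → AtHome L j w) →
                ∀ {w} → Level i w → ∀ v → ∃[ j ] Level j (inject w v) →
                (∃[ j ] j < i × AtHome L j (inject w v))
              ⊎ (w ∈ L × inject w v ∈ L × 2 ∣ i)
              ⊎ (w ∉ L × inject w v ∉ L × 2 ∤ i)
      respond i rec lv v (j , lv′) with m≤n⇒m<n∨m≡n (level-greatest lv (deep-inject⁻ (proj₁ lv′)))
      ... | inj₁ j<i = inj₁ (j , j<i , rec j<i lv′)
      ... | inj₂ refl with 2 ∣? i
      ...   | yes even = inj₂ (inj₁ (from (level⇒∈⇔even lv) even , from (level⇒∈⇔even lv′) even , even))
      ...   | no odd   = inj₂ (inj₂ (odd ∘ to (level⇒∈⇔even lv) , odd ∘ to (level⇒∈⇔even lv′) , odd))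

    -- Both letters of index `i` are injected at every position of `J`. They spoil calmness at
    -- `i + 1` for both sides, but are not relevant at `i`, so calmness there survives.
    lowering : ∀ {i w J} → StrictlyIncreasing J → Deep i w →
               ∃[ v ] InvariantInjection L J w v × Level i (inject w v)
    lowering {i} {w} {J} inc deep@(i≤k , b , fin) = v , invariant , level-intro i≤k (b , calm) often
      where
      both : Dec (i < k) → List Letter
      both (yes i<k) = letter (fromℕ< i<k) zero ∷ letter (fromℕ< i<k) (suc zero) ∷ []
      -- Here `i = k` and no letter of index `i` exists; nothing is injected.
      both (no _)    = []

      v′ : ∀ p → Dec (∃[ n ] J n ≡ p) → List Letter
      v′ p (yes _) = both (i <? k)
      v′ p (no _)  = []

      v : ℕ → List Letter
      v p = v′ p em

      invariant : InvariantInjection L J w v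
      invariant p with em {∃[ n ] J n ≡ p}
      ... | yes p∈J = inj₂ (p∈J , singleResidual (prefix w (suc p)) (prefix w (suc p) ++ both (i <? k)))
      ... | no _    = inj₁ refl

      unhit : ∀ d → All (∁ (Hits i b)) (both d)
      unhit (yes i<k) = All.tabulate λ where
        (here refl)         hits → <-irrefl (toℕ-fromℕ< i<k) (proj₁ (hits-letter (fromℕ< i<k) hits))
        (there (here refl)) hits → <-irrefl (toℕ-fromℕ< i<k) (proj₁ (hits-letter (fromℕ< i<k) hits))
      unhit (no _)    = []

      unhit′ : ∀ p d → All (∁ (Hits i b)) (v′ p d)
      unhit′ p (yes _) = unhit (i <? k)
      unhit′ p (no _)  = []

      both-∈ : ∀ d j c → toℕ j ≡ i → letter j c ∈ₗ both d
      both-∈ (no i≮k)  j c          refl = contradiction (toℕ<n j) i≮k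
      both-∈ (yes i<k) j c          j≡i with fromℕ< i<k | toℕ-injective (trans (toℕ-fromℕ< i<k) (sym j≡i))
      both-∈ (yes i<k) j zero       j≡i | _ | refl = here refl
      both-∈ (yes i<k) j (suc zero) j≡i | _ | refl = there (here refl)

      v-∈ : ∀ j c → toℕ j ≡ i → ∀ n → letter j c ∈ₗ v (J n)
      v-∈ j c j≡i n with em {∃[ n′ ] J n′ ≡ J n}
      ... | yes _   = both-∈ (i <? k) j c j≡i
      ... | no none = contradiction (n , refl) none

      calm : FinitelyOften (λ n → Hits i b (inject w v n))
      calm = inject-finitely⁺ (Hits i b) w v (λ p → unhit′ p em) fin

      often : ∀ j c → toℕ j ≡ i → Inf (λ n → inject w v n ≡ letter j c)
      often j c j≡i = inject-inf inc (v-∈ j c j≡i)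

    -- Whatever `J` is, a word deep at `i + 1` can be lowered to level exactly `i + 1`. The result
    -- has the wrong parity for `i`, and by induction it is not at home in a smaller colour.
    atHome⇒¬deep : ∀ i {w} → AtHome L i w → ¬ Deep (suc i) w
    atHome⇒¬deep = <-rec _ λ where
      i rec (atHome J inc respond) deep → let v , invariant , lv = lowering inc deep in
        [ (λ (j , j<i , home) → rec j<i home (deep-antitone (≤-trans j<i (n≤1+n i)) (proj₁ lv)))
        , [ (λ (_ , ∈L , even) → even-suc i even (to (level⇒∈⇔even lv) ∈L))
          , (λ (_ , ∉L , odd) → ∉L (from (level⇒∈⇔even lv) (odd-suc i odd))) ]′ ]′ (respond v invariant)

    level⇔naturalColour : ∀ {i w} → Level i w ⇔ NaturalColour L i w
    level⇔naturalColour {i} {w} = mk⇔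
      (λ lv@(deep , _) → level⇒atHome i lv , λ j home →
        ≮⇒≥ λ j<i → atHome⇒¬deep j home (deep-antitone j<i deep))
      (λ (home , least) → let l , lv@(deep , _) = level-exists w in
        subst (λ i → Level i w)
          (≤-antisym (≮⇒≥ λ i<l → atHome⇒¬deep i home (deep-antitone i<l deep))
                     (least l (level⇒atHome l lv))) lv)

    -- Regularity

    -- A number codes the tuple of states of all trackers; the same coding later enumerates the
    -- branches of the Zielonka tree.
    bits : Fin (2 ^ k) → Fin k → Fin 2
    bits = finToFun

    bits-injective : ∀ {e e′} → (∀ j → bits e j ≡ bits e′ j) → e ≡ e′
    bits-injective {e} {e′} eq = trans (sym (funToFin-finToFin {k} {2} e))
      (trans (funToFin-cong eq) (funToFin-finToFin {k} {2} e′))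

    productKill? : ∀ (q : Fin (2 ^ k)) x j → Dec (Kill (suc (toℕ j)) (bits q j) x)
    productKill? q x j = kill? (suc (toℕ j)) (bits q j) x

    productNext : Fin (2 ^ k) → Letter → Fin (2 ^ k)
    productNext q x = funToFin {k} {2} λ j → track (suc (toℕ j)) (bits q j) x

    productColour : Fin (2 ^ k) → Letter → ℕ
    productColour q x = first (productKill? q x)

    -- All trackers run in parallel, and the colour names the first one that rejects. This
    -- deterministic parity automaton for `L` has `2 ^ k` states, so the lower bound is attained.
    product : Automaton (k * 2)
    product = functional (funToFin {k} {2} λ _ → zero) productNext productColour

    product-deterministic : Automaton.Deterministic product
    product-deterministic = functional-deterministic (funToFin {k} {2} λ _ → zero) productNext productColour

    module _ {w : Word (k * 2)} where

      open Determinism product product-deterministic using (run; run-suc; colours; ∈⇔accepting)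

      private
        q : ℕ → Fin (2 ^ k)
        q = run (funToFin {k} {2} λ _ → zero) w

        c : ℕ → ℕ
        c = colours w

        killsOf : Fin k → Pred ℕ 0ℓ
        killsOf j n = Kill (suc (toℕ j)) (bits (q n) j) (w n)

        component : ∀ j n → bits (q (suc n)) j ≡ track (suc (toℕ j)) (bits (q n) j) (w n)
        component j n = trans (cong (λ q → bits q j) (run-suc _ w n)) (finToFun-funToFin {k} {2} _ j)

      -- Colour `e` requires a kill in the tracker of `e + 1`, so colours below the level die out.
      -- If colour `i` died out as well, the tracker of `i + 1` would stop killing, or for `i = k`
      -- no colour would remain.
      colours-least : ∀ {i} → Level i w → Least (λ e → Inf (λ n → c n ≡ e)) i
      colours-least {i} (deep , ¬deep) = inf , λ e inf-e → ≮⇒≥ (inf-e ∘ finite-below e)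
        where
        finite-below : ∀ e → e < i → FinitelyOften (λ n → c n ≡ e)
        finite-below e e<i = finitely-⊆ {Q = killsOf j}
          (λ {n} c≡e → first-holds (productKill? (q n) (w n)) j (trans c≡e (sym j≡e)))
          (calm⇒kills-finite {w = w} (component j)
            (proj₂ (deep-antitone (subst (λ e → suc e ≤ i) (sym j≡e) e<i) deep)))
          where
          e<k : e < k
          e<k = ≤-trans e<i (proj₁ deep)

          j : Fin k
          j = fromℕ< e<k

          j≡e : toℕ j ≡ e
          j≡e = toℕ-fromℕ< e<k

        finite-upto : FinitelyOften (λ n → c n ≡ i) → FinitelyOften (λ n → c n ≤ i)
        finite-upto fin = finitely-≤ i λ e e≤i →
          [ finite-below e , (λ { refl → fin }) ]′ (m≤n⇒m<n∨m≡n e≤i)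

        calm-at : ∀ j → toℕ j ≡ i → FinitelyOften (λ n → c n ≤ i) → Calm (suc (toℕ j)) w
        calm-at j j≡i = kills-finite⇒calm {w = w} (component j) ∘
          -- A kill at position `j` bounds the first killing position, and hence the colour, by `j`.
          finitely-⊆ λ {n} kill → subst (c n ≤_) j≡i (first-lower (productKill? (q n) (w n)) j kill)

        inf : Inf (λ n → c n ≡ i)
        inf fin with m≤n⇒m<n∨m≡n (proj₁ deep)
        ... | inj₂ refl = let N , never = finite-upto fin in never N ≤-refl (first-≤ (productKill? (q N) (w N)))
        ... | inj₁ i<k  = ¬deep (i<k , subst (λ i → Calm (suc i) w) (toℕ-fromℕ< i<k)
                                         (calm-at (fromℕ< i<k) (toℕ-fromℕ< i<k) (finite-upto fin)))

      ∈product⇔∈L : w ∈ ⟦ product ⟧ ⇔ w ∈ L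
      ∈product⇔∈L with _ , lv ← level-exists w =
        ⇔-trans (∈⇔accepting {w}) (⇔-trans (accepting⇔even (colours-least lv)) (⇔-sym (level⇒∈⇔even lv)))

    regular : ωRegular L
    regular = product , to ∈product⇔∈L , from ∈product⇔∈L

    -- Strict nesting and the conditions on a COCOA

    level-cyc : ∀ {i x u} v → i ≤ k → (∃[ b ] (∀ {y} → y ∈ₗ x ∷ u → ¬ Hits i b y)) →
                (∀ j b → toℕ j ≡ i → letter j b ∈ₗ x ∷ u) → Level i (cyc x u v)
    level-cyc {i} v i≤k (b , ¬hits) both =
      level-intro i≤k (b , cyc-finite (Hits i b) v ¬hits) λ j c j≡i → cyc-inf v (both j c j≡i)

    -- Alternating the two letters of index `i` gives a word of level exactly `i`, which separates
    -- the two layers.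
    nested : ∀ i → 1 ≤ i → i < k → Layer chain i ⊃ Layer chain (suc i)
    nested (suc i) _ si<k =
      (λ layer → deep⇒layer (deep-antitone (n≤1+n _) (layer⇒deep layer))) ,
      λ sub → ¬deep (layer⇒deep (sub (deep⇒layer deep)))
      where
      j : Fin k
      j = fromℕ< si<k

      j≡si : toℕ j ≡ suc i
      j≡si = toℕ-fromℕ< si<k

      unhit : ∀ {y} → y ∈ₗ letter j zero ∷ letter j (suc zero) ∷ [] → ¬ Hits (suc i) zero y
      unhit (here refl)         hits = <-irrefl j≡si (proj₁ (hits-letter j hits))
      unhit (there (here refl)) hits = <-irrefl j≡si (proj₁ (hits-letter j hits))

      both : ∀ j′ b → toℕ j′ ≡ suc i → letter j′ b ∈ₗ letter j zero ∷ letter j (suc zero) ∷ []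
      both j′ b j′≡si with toℕ-injective (trans j′≡si (sym j≡si))
      both j′ zero       _ | refl = here refl
      both j′ (suc zero) _ | refl = there (here refl)

      lv : Level (suc i) (cyc (letter j zero) (letter j (suc zero) ∷ []) [])
      lv = level-cyc [] (<⇒≤ si<k) (zero , unhit) both

      deep = proj₁ lv
      ¬deep = proj₂ lv

    isCOCOA : IsCOCOA chain
    isCOCOA = record
      { regular  = regular
      ; coBüchi  = λ j → subst Automaton.CoBüchi (sym (lookup-chain j)) (tracker-coBüchi (suc (toℕ j)))
      ; hd       = λ j → subst HistoryDeterministic (sym (lookup-chain j))
                     (Determinism.historyDeterministic (tracker (suc (toℕ j))) (tracker-deterministic (suc (toℕ j))))
      ; nested   = nested
      ; colour-0 = (λ {w} ∉layer → to level⇔naturalColour (deep-0 w , ∉layer ∘ deep⇒layer))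
                 , (λ nc → proj₂ (from level⇔naturalColour nc) ∘ layer⇒deep)
      ; colour-i = λ { (suc i) _ _ →
          (λ (∈layer , ∉layer) → to level⇔naturalColour (layer⇒deep ∈layer , ∉layer ∘ deep⇒layer))
        , (λ nc → let deep , ¬deep = from level⇔naturalColour nc in deep⇒layer deep , ¬deep ∘ layer⇒deep) }
      }

    tracker-states : ∀ j → Automaton.states (lookup chain j) ≡ 2
    tracker-states j = cong Automaton.states (lookup-chain j)

    -- Lower bound

    -- The letters remaining at depth i of the Zielonka tree of L, on the branch β: choosing
    -- β j at depth j discards the letters of that side with index at most j.
    Node : ℕ → (Fin k → Fin 2) → Pred Letter 0ℓ
    Node i β x = ∀ j → toℕ j < i → β j ≡ side x → toℕ j < toℕ (index x)

    node-antitone : ∀ {i j β x} → i ≤ j → Node j β x → Node i β x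
    node-antitone i≤j node j′ j′<i = node j′ (<-≤-trans j′<i i≤j)

    node-letter : ∀ {i β} j b → (∀ j′ → toℕ j′ < i → β j′ ≡ b → toℕ j′ < toℕ j) → Node i β (letter j b)
    node-letter j b above j′ j′<i β≡ rewrite index-letter j b | side-letter j b = above j′ j′<i β≡

    -- Choices before depth `j` discard only smaller indices, and the choice at `j` discards the
    -- other side.
    node-beside : ∀ {β} j {b} → β j ≢ b → Node (suc (toℕ j)) β (letter j b)
    node-beside {β} j {b} βj≢b = node-letter j b λ j′ j′≤j βj′≡b →
      [ id , (λ j′≡j → contradiction (trans (cong β (sym (toℕ-injective j′≡j))) βj′≡b) βj≢b) ]′
        (m≤n⇒m<n∨m≡n (s≤s⁻¹ j′≤j))

    -- The last choice, at depth `i - 1`, discards all letters of its side with index below `i`. At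
    -- the root no letter is relevant, and either side would do.
    node-calm : ∀ {i} β → i ≤ k → ∃[ b ] (∀ {x} → Node i β x → ¬ Hits i b x)
    node-calm {zero}  β i≤k = zero , λ _ ()
    node-calm {suc i} β i<k = β j , λ { node (s≤s idx≤i , side≡) →
      <⇒≱ (node j (s≤s (≤-reflexive j≡i)) (sym side≡)) (subst (_ ≤_) (sym j≡i) idx≤i) }
      where
      j : Fin k
      j = fromℕ< i<k

      j≡i : toℕ j ≡ i
      j≡i = toℕ-fromℕ< i<k

    module LowerBound (P : Automaton (k * 2)) (det : Automaton.Deterministic P) (P≐L : ⟦ P ⟧ ≐ L) where

      open Automaton P using (State; initial)
      open Determinism P det

      steps-++ : ∀ q u v → steps q (u ++ v) ≡ steps (steps q u) v
      steps-++ = foldl-++ next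

      Reach : Pred Letter 0ℓ → State → State → Set
      Reach S p q = ∃[ u ] All S u × steps p u ≡ q

      reach-refl : ∀ {S p} → Reach S p p
      reach-refl = [] , [] , refl

      reach-trans : ∀ {S p q r} → Reach S p q → Reach S q r → Reach S p r
      reach-trans {p = p} (u , Su , refl) (v , Sv , refl) = u ++ v , ++⁺ Su Sv , steps-++ p u v

      -- The state lies in a terminal strongly connected component of the transition graph
      -- restricted to letters in `S`.
      Recurrent : Pred Letter 0ℓ → State → Set
      Recurrent S p = ∀ {q} → Reach S p q → Reach S q p

      recurrent-reach : ∀ {S p q} → Recurrent S p → Reach S p q → Recurrent S q
      recurrent-reach rec pq qr = reach-trans (rec (reach-trans pq qr)) pq

      branch-recurrent : ∀ β i → ∃[ q ] (∃[ z ] steps initial z ≡ q) ×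
                         (∀ j → j ≤ i → Recurrent (Node j β) q)
      branch-recurrent β zero
        with q , (z , _ , eq) , rec ← maximal-above {R = Reach (Node 0 β)} reach-refl reach-trans initial
        = q , (z , eq) , λ { zero z≤n → rec }
      branch-recurrent β (suc i)
        with p , (z , refl) , rec ← branch-recurrent β i
        with q , (u , Su , refl) , rec′ ← maximal-above {R = Reach (Node (suc i) β)} reach-refl reach-trans p
        = q , (z ++ u , steps-++ initial z u) , λ j j≤si → rec″ j (m≤n⇒m<n∨m≡n j≤si)
        where
        rec″ : ∀ j → j < suc i ⊎ j ≡ suc i → Recurrent (Node j β) (steps p u)
        rec″ j (inj₂ refl) = rec′
        -- The word `u` uses letters of the child only; these belong to every ancestor, so the move
        -- stays within the ancestors' components.
        rec″ j (inj₁ (s≤s j≤i)) = recurrent-reach (rec j j≤i)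
          (u , All.map (node-antitone (≤-trans j≤i (n≤1+n i))) Su , refl)

      -- Recurrence allows any letter of `S` to be read at `q` and a return to `q` afterwards; these
      -- excursions are concatenated.
      loop-through : ∀ {S q} → Recurrent S q → ∀ xs →
                     ∃[ u ] All S u × steps q u ≡ q × (∀ {x} → x ∈ₗ xs → S x → x ∈ₗ u)
      loop-through rec [] = [] , [] , refl , λ ()
      loop-through {S} {q} rec (x ∷ xs)
        with u , Su , loop , through ← loop-through rec xs | em {S x}
      ... | no ¬Sx = u , Su , loop , λ { (here refl) Sx → contradiction Sx ¬Sx ; (there x∈) → through x∈ }
      ... | yes Sx with v , Sv , back ← rec (x ∷ [] , Sx ∷ [] , refl) =
        x ∷ v ++ u , Sx ∷ ++⁺ Sv Su ,
        trans (steps-++ (next q x) v u) (trans (cong (λ q → steps q u) back) loop) ,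
        λ { (here refl) _ → here refl ; (there x∈) Sx → there (∈-++⁺ʳ v (through x∈ Sx)) }

      full-loop : ∀ {S q} → Recurrent S q → ∃ S →
                  ∃[ x ] ∃[ u ] All S (x ∷ u) × steps q (x ∷ u) ≡ q × (∀ {y} → S y → y ∈ₗ x ∷ u)
      full-loop rec (y , Sy) with loop-through rec (allFin (k * 2))
      -- An element of `S` has to occur on the loop, so the loop is nonempty and can serve as a
      -- period.
      ... | []    , _  , _    , through = case through (∈-allFin y) Sy of λ ()
      ... | x ∷ u , Su , loop , through = x , u , Su , loop , through (∈-allFin _)

      -- Both parities decide membership of the same word: the level does so for `L`, the least
      -- colour of the loop for `P`.
      level-parity : ∀ {q x u i d} z → steps q (x ∷ u) ≡ q → steps initial z ≡ q →
                     IsMinimum (coloursAlong q (x ∷ u)) d → Level i (cyc x u z) → 2 ∣ i ⇔ 2 ∣ d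
      level-parity z loop eq min lv = ⇔-trans (⇔-sym (level⇒∈⇔even lv))
        (⇔-trans (mk⇔ (proj₂ P≐L) (proj₁ P≐L)) (cyc∈⇔even loop z eq min))

      minimum-++ : ∀ {q d₁ d₂} u₁ u₂ → steps q u₁ ≡ q →
                   IsMinimum (coloursAlong q u₁) d₁ → IsMinimum (coloursAlong q u₂) d₂ →
                   IsMinimum (coloursAlong q (u₁ ++ u₂)) d₁ ⊎ IsMinimum (coloursAlong q (u₁ ++ u₂)) d₂
      minimum-++ {q} {d₁} {d₂} u₁ u₂ loop (d₁∈ , d₁≤) (d₂∈ , d₂≤)
        rewrite coloursAlong-++ q u₁ u₂ | loop with ≤-total d₁ d₂
      ... | inj₁ d₁≤d₂ = inj₁ (∈-++⁺ˡ d₁∈ , ++⁺ d₁≤ (All.map (≤-trans d₁≤d₂) d₂≤))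
      ... | inj₂ d₂≤d₁ = inj₂ (∈-++⁺ʳ _ d₂∈ , ++⁺ (All.map (≤-trans d₂≤d₁) d₁≤) d₂≤)

      -- Full loops for two sibling nodes at depth m + 1 have level m + 1 each, but their
      -- concatenation has level m, while its least colour is that of one of the two loops.
      siblings-disjoint : ∀ {q β β′} z (m : Fin k) → steps initial z ≡ q →
                          β m ≢ β′ m → (∀ j → toℕ j < toℕ m → β j ≡ β′ j) →
                          Recurrent (Node (suc (toℕ m)) β) q → Recurrent (Node (suc (toℕ m)) β′) q → ⊥
      siblings-disjoint {q} {β} {β′} z m reach β≢β′ agree rec rec′
        -- The letter of index `m` on the side that is not discarded shows that each sibling node is
        -- nonempty.
        with x₁ , u₁ , S₁ , loop₁ , full₁ ← full-loop rec  (_ , node-beside m (opposite-≢ (β m) ∘ sym))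
           | x₂ , u₂ , S₂ , loop₂ , full₂ ← full-loop rec′ (_ , node-beside m (opposite-≢ (β′ m) ∘ sym))
        with d₁ , min₁ ← minimum-exists (colour q x₁) (coloursAlong (next q x₁) u₁)
           | d₂ , min₂ ← minimum-exists (colour q x₂) (coloursAlong (next q x₂) u₂)
        = [ (λ min → absurd (⇔-trans parity₁ (⇔-sym (parity min))))
          , (λ min → absurd (⇔-trans parity₂ (⇔-sym (parity min)))) ]′
          (minimum-++ (x₁ ∷ u₁) (x₂ ∷ u₂) loop₁ min₁ min₂)
        where
        i : ℕ
        i = toℕ m

        node-level : ∀ {x u} β → All (Node (suc i) β) (x ∷ u) → (∀ {y} → Node (suc i) β y → y ∈ₗ x ∷ u) →
                     Level (suc i) (cyc x u z)
        node-level β Su full with b , unhit ← node-calm β (toℕ<n m) =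
          level-cyc z (toℕ<n m) (b , unhit ∘ All.lookup Su) λ j b j≡si →
            full (node-letter j b λ j′ j′<si _ → subst (toℕ j′ <_) (sym j≡si) j′<si)

        parity₁ : 2 ∣ suc i ⇔ 2 ∣ d₁
        parity₁ = level-parity z loop₁ reach min₁ (node-level β S₁ full₁)

        parity₂ : 2 ∣ suc i ⇔ 2 ∣ d₂
        parity₂ = level-parity z loop₂ reach min₂ (node-level β′ S₂ full₂)

        siblings⊆parent : ∀ {y} → y ∈ₗ x₁ ∷ u₁ ++ x₂ ∷ u₂ → Node i β y
        siblings⊆parent y∈ with ∈-++⁻ (x₁ ∷ u₁) y∈
        ... | inj₁ y∈₁ = node-antitone (n≤1+n i) (All.lookup S₁ y∈₁)
        -- The branches agree above depth `m`, so the second sibling has the same parent.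
        ... | inj₂ y∈₂ = λ j j<i β≡ →
          All.lookup S₂ y∈₂ j (≤-trans j<i (n≤1+n i)) (trans (sym (agree j j<i)) β≡)

        both : ∀ j b → toℕ j ≡ i → letter j b ∈ₗ x₁ ∷ u₁ ++ x₂ ∷ u₂
        -- The siblings discard different sides, so each letter of index `m` remains in at least one
        -- of them.
        both j b j≡i with toℕ-injective j≡i | β m ≟ b
        ... | refl | no βm≢b  = ∈-++⁺ˡ (full₁ (node-beside m βm≢b))
        ... | refl | yes refl = ∈-++⁺ʳ (x₁ ∷ u₁) (full₂ (node-beside m (β≢β′ ∘ sym)))

        parent-level : Level i (cyc x₁ (u₁ ++ x₂ ∷ u₂) z)
        parent-level with b , unhit ← node-calm β (<⇒≤ (toℕ<n m)) =
          level-cyc z (<⇒≤ (toℕ<n m)) (b , unhit ∘ siblings⊆parent) both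

        loop : steps q (x₁ ∷ u₁ ++ x₂ ∷ u₂) ≡ q
        loop = trans (steps-++ (next q x₁) u₁ (x₂ ∷ u₂)) (trans (cong (λ q → steps q (x₂ ∷ u₂)) loop₁) loop₂)

        parity : ∀ {d} → IsMinimum (coloursAlong q (x₁ ∷ u₁ ++ x₂ ∷ u₂)) d → 2 ∣ i ⇔ 2 ∣ d
        parity min = level-parity z loop reach min parent-level

        absurd : ¬ (2 ∣ suc i ⇔ 2 ∣ i)
        absurd si⇔i with 2 ∣? i
        ... | yes even = even-suc i even (from si⇔i even)
        ... | no odd   = odd (to si⇔i (odd-suc i odd))

      branchState : Fin (2 ^ k) → State
      branchState e = proj₁ (branch-recurrent (bits e) k)

      branchState-injective : ∀ {e e′} → branchState e ≡ branchState e′ → e ≡ e′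
      branchState-injective {e} {e′} eq = decidable-stable (e ≟ e′) λ e≢e′ →
        -- The branches part at the first differing bit `m`. Both states are recurrent at every
        -- depth up to `k`, in particular at `m + 1`, just below the parting.
        let m , βm≢ , below = ¬∀⟶∃¬-smallest k _ (λ j → bits e j ≟ bits e′ j) (e≢e′ ∘ bits-injective)
        in siblings-disjoint (proj₁ reach) m (proj₂ reach) βm≢
             (λ j j<m → subst (λ j → bits e j ≡ bits e′ j)
               (toℕ-injective (trans (toℕ-inject (fromℕ< j<m)) (toℕ-fromℕ< j<m))) (below (fromℕ< j<m)))
             (rec _ (toℕ<n m)) (subst (Recurrent _) (sym eq) (rec′ _ (toℕ<n m)))
        where
        open Σ (proj₂ (branch-recurrent (bits e) k)) renaming (proj₁ to reach; proj₂ to rec)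
        open Σ (proj₂ (branch-recurrent (bits e′) k)) using () renaming (proj₂ to rec′)

      2^k≤states : 2 ^ k ≤ Automaton.states P
      2^k≤states = injective⇒≤ branchState-injective

theorem4p3 : ExcludedMiddle 0ℓ →
    Σ[ alphabet ∈ (ℕ → ℕ) ]
    Σ[ C ∈ ((k : ℕ) → Vec (Automaton (alphabet k)) k) ]
    ((k : ℕ) → 1 ≤ k →
    IsCOCOA (C k)
    × (∀ j → Automaton.states (lookup (C k) j) ≡ 2)
    × SingleResidual (ChainLanguage (C k))
    × ((P : Automaton (alphabet k)) → Automaton.Deterministic P →
    ⟦ P ⟧ ≐ ChainLanguage (C k) → 2 ^ k ≤ Automaton.states P))
theorem4p3 em = (_* 2) , chain , λ k _ →
    isCOCOA k , tracker-states k , singleResidual k , LowerBound.2^k≤states k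
  where open Family em
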